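{- For all integers $N,k,n\geqslant 0$, $$p(N,k,n) = \sum_{j=0}^{\lfloor k/2 \rfloor} \overline{p}_2\Bigg( N,\;N+1-k+2j,\;j,\;k-2j,\;n-\binom{k-2j}{2}\Bigg).$$
   Context: For integers $N,k,n\geqslant 0$, $p(N,k,n)$ denotes the number of partitions of $n$ into at most $k$ parts, each part less than or equal to $N$ (the empty partition is the unique partition of $0$). Assume there are positive integers of two kinds, $\lambda$ (first kind) and $\overline{\lambda}$ (second kind). For an integer $r\geqslant 1$ and integers $N_1,N_2,k_1,k_2,n\geqslant 0$, $\overline{p}_r(N_1,N_2,k_1,k_2,n)$ denotes the number of partitions of $n$ into parts of two kinds with at most $k_1$ parts of the first kind, each divisible by $r$ and less than or equal to $N_1r$, and at most $k_2$ parts of the second kind, each less than or equal to $N_2$ (the order of the parts is irrelevant). For example $\overline{p}_2(2,3,2,2,4)=6$, the partitions being $4$, $2+2$, $2+\overline{2}$, $2+\overline{1}+\overline{1}$, $\overline{3}+\overline{1}$, $\overline{2}+\overline{2}$. Convention: $\overline{p}_r(N_1,N_2,k_1,k_2,n)=0$ whenever any of $N_1,N_2,k_1,k_2,n$ is negative. Also $\binom{m}{2}=m(m-1)/2$. -}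

module Defs where

open import Data.Integer.Base using (ℤ; +_)
open import Data.List.Base using (List; []; _∷_; length; map; filter; upTo; cartesianProduct; cartesianProductWith)
open import Data.List.Membership.Propositional using (_∈_)
open import Data.List.Membership.Propositional.Properties
  using (∈-upTo⁺; ∈-filter⁺; ∈-filter⁻; ∈-cartesianProduct⁺; ∈-cartesianProductWith⁺; ∈-cartesianProductWith⁻)
open import Data.List.Properties using (∷-injective)
open import Data.List.Relation.Unary.All as All using (All; []; _∷_; all?)
open import Data.List.Relation.Unary.AllPairs using ([]; _∷_)
open import Data.List.Relation.Unary.Any using (here; there)
open import Data.List.Relation.Unary.Linked using (Linked; linked?)
open import Data.List.Relation.Unary.Unique.Propositional using (Unique)
open import Data.List.Relation.Unary.Unique.Propositional.Properties
  using (filter⁺; upTo⁺; cartesianProduct⁺; cartesianProductWith⁺)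
open import Data.Nat.Base using (ℕ; zero; suc; _+_; _*_; _≤_; _<_; _≥_; z≤n; s≤s; NonZero)
open import Data.Nat.Divisibility using (_∣_; _∣?_)
open import Data.Nat.ListAction using (sum)
open import Data.Nat.Properties
  using (_≟_; _≤?_; _<?_; _≥?_; ≤-trans; ≤-reflexive; m≤m+n; m≤n+m; +-mono-≤)
open import Data.Product.Base using (_×_; _,_; proj₂)
open import Function.Base using (_∘_)
open import Function.Bundles using (_⇔_; mk⇔)
open import Relation.Binary.PropositionalEquality using (_≡_; _≢_; refl)
open import Relation.Nullary.Decidable using (_×-dec_)
open import Relation.Unary using (Decidable)

IsPartition : List ℕ → Set
IsPartition ps = All (0 <_) ps × Linked _≥_ ps

isPartition? : Decidable IsPartition
isPartition? ps = all? (0 <?_) ps ×-dec linked? _≥?_ ps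

Boxed : (N k n : ℕ) → List ℕ → Set
Boxed N k n ps = IsPartition ps × sum ps ≡ n × length ps ≤ k × All (_≤ N) ps

boxed? : ∀ N k n → Decidable (Boxed N k n)
boxed? N k n ps =
  isPartition? ps ×-dec (sum ps ≟ n) ×-dec (length ps ≤? k) ×-dec all? (_≤? N) ps

-- A partition into parts of two kinds, the order of the parts being irrelevant,
-- is the pair (ps , qs) of its parts of the first and of the second kind.
TwoKind : (r N₁ N₂ k₁ k₂ n : ℕ) → List ℕ × List ℕ → Set
TwoKind r N₁ N₂ k₁ k₂ n (ps , qs) =
  IsPartition ps × IsPartition qs × sum ps + sum qs ≡ n ×
  length ps ≤ k₁ × All (λ x → r ∣ x × x ≤ N₁ * r) ps ×
  length qs ≤ k₂ × All (_≤ N₂) qs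

twoKind? : ∀ r N₁ N₂ k₁ k₂ n → Decidable (TwoKind r N₁ N₂ k₁ k₂ n)
twoKind? r N₁ N₂ k₁ k₂ n (ps , qs) =
  isPartition? ps ×-dec isPartition? qs ×-dec (sum ps + sum qs ≟ n) ×-dec
  (length ps ≤? k₁) ×-dec all? (λ x → (r ∣? x) ×-dec (x ≤? N₁ * r)) ps ×-dec
  (length qs ≤? k₂) ×-dec all? (_≤? N₂) qs

-- All lists of length at most l with entries at most m.
words : (m l : ℕ) → List (List ℕ)
words m zero    = [] ∷ []
words m (suc l) = [] ∷ cartesianProductWith _∷_ (upTo (suc m)) (words m l)

-- A partition of n has at most n parts, each at most n, so words n n is a large
-- enough search space; ∈-boxed, ∈-twoKind and the uniqueness lemmas below confirm
-- that each object is listed exactly once.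
boxed : (N k n : ℕ) → List (List ℕ)
boxed N k n = filter (boxed? N k n) (words n n)

twoKind : (r N₁ N₂ k₁ k₂ n : ℕ) → List (List ℕ × List ℕ)
twoKind r N₁ N₂ k₁ k₂ n =
  filter (twoKind? r N₁ N₂ k₁ k₂ n) (cartesianProduct (words n n) (words n n))

p : (N k n : ℕ) → ℕ
p N k n = length (boxed N k n)

-- Zero by convention as soon as one of the integer arguments is negative.
pbar : (r : ℕ) .{{_ : NonZero r}} (N₁ N₂ k₁ k₂ n : ℤ) → ℕ
pbar r (+ N₁) (+ N₂) (+ k₁) (+ k₂) (+ n) = length (twoKind r N₁ N₂ k₁ k₂ n)
pbar _ _ _ _ _ _ = 0

-- The sum of f j over 0 ≤ j ≤ m, both ends included.
∑[0⋯_] : ℕ → (ℕ → ℕ) → ℕ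
∑[0⋯ m ] f = sum (map f (upTo (suc m)))

words-unique : ∀ m l → Unique (words m l)
words-unique m zero    = [] ∷ []
words-unique m (suc l) =
  All.tabulate (nonempty (upTo (suc m))) ∷
  cartesianProductWith⁺ _∷_ ∷-injective (upTo⁺ (suc m)) (words-unique m l)
  where
  nonempty : (ys : List ℕ) {xs : List ℕ} →
             xs ∈ cartesianProductWith _∷_ ys (words m l) → [] ≢ xs
  nonempty ys xs∈ refl with ∈-cartesianProductWith⁻ _∷_ ys (words m l) xs∈
  ... | _ , _ , _ , _ , ()

∈-words : ∀ {m l xs} → All (_≤ m) xs → length xs ≤ l → xs ∈ words m l
∈-words {l = zero}  []         z≤n      = here refl
∈-words {l = suc l} []         z≤n      = here refl
∈-words {l = suc l} (x≤ ∷ xs≤) (s≤s le) =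
  there (∈-cartesianProductWith⁺ _∷_ (∈-upTo⁺ (s≤s x≤)) (∈-words xs≤ le))

parts≤sum : ∀ xs → All (_≤ sum xs) xs
parts≤sum []       = []
parts≤sum (x ∷ xs) =
  m≤m+n x (sum xs) ∷ All.map (λ y≤ → ≤-trans y≤ (m≤n+m (sum xs) x)) (parts≤sum xs)

length≤sum : ∀ {xs} → All (0 <_) xs → length xs ≤ sum xs
length≤sum []         = z≤n
length≤sum (0<x ∷ ps) = +-mono-≤ 0<x (length≤sum ps)

partition∈words : ∀ {xs n} → IsPartition xs → sum xs ≤ n → xs ∈ words n n
partition∈words {xs} (pos , _) s≤n =
  ∈-words (All.map (λ x≤ → ≤-trans x≤ s≤n) (parts≤sum xs)) (≤-trans (length≤sum pos) s≤n)

boxed-unique : ∀ N k n → Unique (boxed N k n)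
boxed-unique N k n = filter⁺ (boxed? N k n) (words-unique n n)

∈-boxed : ∀ N k n ps → ps ∈ boxed N k n ⇔ Boxed N k n ps
∈-boxed N k n ps = mk⇔
  (proj₂ ∘ ∈-filter⁻ (boxed? N k n) {xs = words n n})
  (λ b@(isP , s≡n , _) → ∈-filter⁺ (boxed? N k n) (partition∈words isP (≤-reflexive s≡n)) b)

twoKind-unique : ∀ r N₁ N₂ k₁ k₂ n → Unique (twoKind r N₁ N₂ k₁ k₂ n)
twoKind-unique r N₁ N₂ k₁ k₂ n =
  filter⁺ (twoKind? r N₁ N₂ k₁ k₂ n) (cartesianProduct⁺ (words-unique n n) (words-unique n n))

∈-twoKind : ∀ r N₁ N₂ k₁ k₂ n pq →
            pq ∈ twoKind r N₁ N₂ k₁ k₂ n ⇔ TwoKind r N₁ N₂ k₁ k₂ n pq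
∈-twoKind r N₁ N₂ k₁ k₂ n (ps , qs) = mk⇔
  (proj₂ ∘ ∈-filter⁻ (twoKind? r N₁ N₂ k₁ k₂ n) {xs = cartesianProduct (words n n) (words n n)})
  (λ t@(isP , isQ , s≡n , _) → ∈-filter⁺ (twoKind? r N₁ N₂ k₁ k₂ n)
    (∈-cartesianProduct⁺
      (partition∈words isP (≤-trans (m≤m+n (sum ps) (sum qs)) (≤-reflexive s≡n)))
      (partition∈words isQ (≤-trans (m≤n+m (sum qs) (sum ps)) (≤-reflexive s≡n))))
    t)

{-# OPTIONS --safe #-}
-- p(N, k, ·) counts the k-element multisets drawn from {0, …, N} by their sum. Writing
-- every multiplicity as 2 a + b with b ∈ {0, 1} splits such a multiset into a doubled
-- j-element multiset and a (k − 2 j)-element subset of {0, …, N}; that is,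
-- (1 − x qⁱ)⁻¹ = (1 − x² q²ⁱ)⁻¹ (1 + x qⁱ) for each i ≤ N. Subtracting the staircase
-- 0, 1, …, k − 2 j − 1 from the subset leaves a partition into at most k − 2 j parts, each
-- at most N + 1 − k + 2 j, and accounts for the binomial coefficient.
module Submission where

open import Defs
open import Data.Empty using (⊥-elim)
open import Data.List.Base using (List; []; _∷_; _++_; length; map; applyUpTo)
open import Data.List.Membership.Propositional using (_∈_)
open import Data.List.Membership.Propositional.Properties using (∈-map⁺; ∈-map⁻; ∈-++⁺ˡ; ∈-++⁺ʳ; ∈-++⁻)
open import Data.List.Membership.Propositional.Properties.WithK using (unique∧set⇒bag)
open import Data.List.Properties using (length-++; length-map; map-upTo)
open import Data.List.Relation.Binary.BagAndSetEquality using (∼bag⇒↭)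
open import Data.List.Relation.Binary.Permutation.Propositional.Properties using (↭-length)
open import Data.List.Relation.Unary.All as All using (All; []; _∷_)
open import Data.List.Relation.Unary.AllPairs using ([]; _∷_)
open import Data.List.Relation.Unary.Any using (here)
open import Data.List.Relation.Unary.Linked as Linked using (Linked; []; [-]; _∷_)
open import Data.List.Relation.Unary.Linked.Properties using (Linked⇒All)
open import Data.List.Relation.Unary.Unique.Propositional using (Unique)
import Data.List.Relation.Unary.Unique.Propositional.Properties as Unique
open import Data.Nat.Base
open import Data.Nat.Combinatorics using (_C_; nC1≡n; nCk+nC[k+1]≡[n+1]C[k+1])
open import Data.Nat.Divisibility using (_∣_; divides; 1∣_; divides-refl)
open import Data.Nat.ListAction using (sum)
open import Data.Nat.Properties
open import Data.Product.Base using (∃; _×_; _,_; proj₁; map₁)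
open import Data.Sum.Base as Sum using (_⊎_; inj₁; inj₂)
open import Data.Unit.Base using (⊤; tt)
open import Function.Base using (_∘_)
open import Function.Bundles using (_⇔_; mk⇔; Equivalence)
open import Relation.Binary.PropositionalEquality
open import Relation.Nullary using (¬_; Dec; yes; no; contradiction)
open import Algebra.Properties.CommutativeSemigroup +-commutativeSemigroup
  using (interchange; x∙yz≈y∙xz; xy∙z≈xz∙y)
open Equivalence using (to; from)

-- Power series and their shifts

Series : Set
Series = ℕ → ℕ

infixl 6 _⊕_
_⊕_ : Series → Series → Series
(f ⊕ g) n = f n + g n

𝟘 : Series
𝟘 _ = 0

𝟙 : Series
𝟙 zero    = 1
𝟙 (suc _) = 0

-- Multiplication by qᵈ. Coefficients below `d` vanish, where the truncated `f (n ∸ d)` would repeat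
-- `f 0`.
shift : ℕ → Series → Series
shift zero    f n       = f n
shift (suc d) f zero    = 0
shift (suc d) f (suc n) = shift d f n

⊕-cong : ∀ {f f′ g g′} → f ≗ f′ → g ≗ g′ → f ⊕ g ≗ f′ ⊕ g′
⊕-cong e e′ n = cong₂ _+_ (e n) (e′ n)

⊕-interchange : ∀ f g h i → (f ⊕ g) ⊕ (h ⊕ i) ≗ (f ⊕ h) ⊕ (g ⊕ i)
⊕-interchange f g h i n = interchange (f n) (g n) (h n) (i n)

shift-cong : ∀ d {f g} → f ≗ g → shift d f ≗ shift d g
shift-cong zero    e n       = e n
shift-cong (suc d) e zero    = refl
shift-cong (suc d) e (suc n) = shift-cong d e n

shift-⊕ : ∀ d f g → shift d (f ⊕ g) ≗ shift d f ⊕ shift d g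
shift-⊕ zero    f g n       = refl
shift-⊕ (suc d) f g zero    = refl
shift-⊕ (suc d) f g (suc n) = shift-⊕ d f g n

shift-𝟘 : ∀ d → shift d 𝟘 ≗ 𝟘
shift-𝟘 zero    n       = refl
shift-𝟘 (suc d) zero    = refl
shift-𝟘 (suc d) (suc n) = shift-𝟘 d n

shift-shift : ∀ a b f → shift a (shift b f) ≗ shift (a + b) f
shift-shift zero    b f n       = refl
shift-shift (suc a) b f zero    = refl
shift-shift (suc a) b f (suc n) = shift-shift a b f n

shift-comm : ∀ a b f → shift a (shift b f) ≗ shift b (shift a f)
shift-comm a b f n = begin
  shift a (shift b f) n  ≡⟨ shift-shift a b f n ⟩
  shift (a + b) f n      ≡⟨ cong (λ d → shift d f n) (+-comm a b) ⟩
  shift (b + a) f n      ≡⟨ shift-shift b a f n ⟨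
  shift b (shift a f) n  ∎
  where open ≡-Reasoning

shift-≤ : ∀ {d n} f → d ≤ n → shift d f n ≡ f (n ∸ d)
shift-≤ f z≤n       = refl
shift-≤ f (s≤s d≤n) = shift-≤ f d≤n

shift-> : ∀ {d n} f → n < d → shift d f n ≡ 0
shift-> {suc d} {zero}  f _         = refl
shift-> {suc d} {suc n} f (s≤s n<d) = shift-> f n<d

-- Multisets and subsets of a progression

-- mult c L k f is f times the generating function of the k-element multisets
-- drawn from {0, c, …, (L − 1) c}.
mult : (c L k : ℕ) → Series → Series
mult c L       zero    f = f
mult c zero    (suc k) f = 𝟘
mult c (suc L) (suc k) f = mult c L (suc k) f ⊕ shift (L * c) (mult c (suc L) k f)

-- dist L k f is f times the generating function of the k-element subsets of
-- {0, …, L − 1}.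
dist : (L k : ℕ) → Series → Series
dist L       zero    f = f
dist zero    (suc k) f = 𝟘
dist (suc L) (suc k) f = dist L (suc k) f ⊕ shift L (dist L k f)

mult-cong : ∀ c L k {f g} → f ≗ g → mult c L k f ≗ mult c L k g
mult-cong c L       zero    e = e
mult-cong c zero    (suc k) e n = refl
mult-cong c (suc L) (suc k) e =
  ⊕-cong (mult-cong c L (suc k) e) (shift-cong (L * c) (mult-cong c (suc L) k e))

-- `mult c L k` is multiplication by a fixed series. With `mult-shift`, this carries the recursion
-- of an inner `dist` through the outer `mult` in `split`.
mult-⊕ : ∀ c L k f g → mult c L k (f ⊕ g) ≗ mult c L k f ⊕ mult c L k g
mult-⊕ c L       zero    f g n = refl
mult-⊕ c zero    (suc k) f g n = refl
mult-⊕ c (suc L) (suc k) f g n = begin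
  mult c (suc L) (suc k) (f ⊕ g) n
    ≡⟨ ⊕-cong (mult-⊕ c L (suc k) f g) (shift-cong (L * c) (mult-⊕ c (suc L) k f g)) n ⟩
  (A f ⊕ A g ⊕ shift (L * c) (B f ⊕ B g)) n
    ≡⟨ ⊕-cong {A f ⊕ A g} (λ _ → refl) (shift-⊕ (L * c) (B f) (B g)) n ⟩
  (A f ⊕ A g ⊕ (shift (L * c) (B f) ⊕ shift (L * c) (B g))) n
    ≡⟨ ⊕-interchange (A f) (A g) (shift (L * c) (B f)) (shift (L * c) (B g)) n ⟩
  (mult c (suc L) (suc k) f ⊕ mult c (suc L) (suc k) g) n ∎
  where
  open ≡-Reasoning
  A B : Series → Series
  A = mult c L (suc k)
  B = mult c (suc L) k

mult-𝟘 : ∀ c L k → mult c L k 𝟘 ≗ 𝟘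
mult-𝟘 c L       zero    n = refl
mult-𝟘 c zero    (suc k) n = refl
mult-𝟘 c (suc L) (suc k) n = cong₂ _+_ (mult-𝟘 c L (suc k) n)
  (trans (shift-cong (L * c) (mult-𝟘 c (suc L) k) n) (shift-𝟘 (L * c) n))

mult-shift : ∀ c L k d f → mult c L k (shift d f) ≗ shift d (mult c L k f)
mult-shift c L       zero    d f n = refl
mult-shift c zero    (suc k) d f n = sym (shift-𝟘 d n)
mult-shift c (suc L) (suc k) d f n = begin
  mult c (suc L) (suc k) (shift d f) n
    ≡⟨ ⊕-cong (mult-shift c L (suc k) d f) (shift-cong (L * c) (mult-shift c (suc L) k d f)) n ⟩
  (shift d A ⊕ shift (L * c) (shift d B)) n
    ≡⟨ ⊕-cong {shift d A} (λ _ → refl) (shift-comm (L * c) d B) n ⟩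
  (shift d A ⊕ shift d (shift (L * c) B)) n
    ≡⟨ shift-⊕ d A (shift (L * c) B) n ⟨
  shift d (mult c (suc L) (suc k) f) n ∎
  where
  open ≡-Reasoning
  A B : Series
  A = mult c L (suc k) f
  B = mult c (suc L) k f

mult-one : ∀ c k f → mult c 1 k f ≗ f
mult-one c zero    f n = refl
mult-one c (suc k) f n = mult-one c k f n

-- Pigeonhole. This case matches a negative bound on the parts of the second kind.
dist-< : ∀ {L k} f → L < k → dist L k f ≗ 𝟘
dist-< {zero}  {suc k} f _         n = refl
dist-< {suc L} {suc k} f (s≤s L<k) n = cong₂ _+_ (dist-< f (m<n⇒m<1+n L<k) n)
  (trans (shift-cong L (dist-< f L<k) n) (shift-𝟘 L n))

[1+n]C2≡n+nC2 : ∀ n → suc n C 2 ≡ n + n C 2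
[1+n]C2≡n+nC2 n = begin
  suc n C 2      ≡⟨ nCk+nC[k+1]≡[n+1]C[k+1] n 1 ⟨
  n C 1 + n C 2  ≡⟨ cong (_+ n C 2) (nC1≡n n) ⟩
  n + n C 2      ∎
  where open ≡-Reasoning

-- Subtracting the staircase m − 1, …, 1, 0 turns an m-element subset into a multiset.
dist-staircase : ∀ d m f → dist (d + m) m f ≗ shift (m C 2) (mult 1 (suc d) m f)
dist-staircase d zero f n = refl
dist-staircase zero (suc m) f n = begin
  dist m (suc m) f n + shift m (dist m m f) n
    -- The only (m + 1)-element subset of {0, ..., m} is the whole set, so m must be chosen.
    ≡⟨ cong₂ _+_ (dist-< f (n<1+n m) n) (shift-cong m (dist-staircase zero m f) n) ⟩
  shift m (shift (m C 2) (mult 1 1 m f)) n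
    ≡⟨ shift-shift m (m C 2) (mult 1 1 m f) n ⟩
  shift (m + m C 2) (mult 1 1 m f) n
    ≡⟨ cong (λ e → shift e (mult 1 1 m f) n) ([1+n]C2≡n+nC2 m) ⟨
  shift (suc m C 2) (mult 1 1 (suc m) f) n ∎
  where open ≡-Reasoning
dist-staircase (suc d) (suc m) f n = begin
  dist (d + suc m) (suc m) f n + shift (d + suc m) (dist (d + suc m) m f) n
    ≡⟨ cong (dist (d + suc m) (suc m) f n +_)
         (cong (λ e → shift e (dist e m f) n) (+-suc d m)) ⟩
  dist (d + suc m) (suc m) f n + shift (suc d + m) (dist (suc d + m) m f) n
    ≡⟨ cong₂ _+_ (dist-staircase d (suc m) f n) (shift-cong (suc d + m) (dist-staircase (suc d) m f) n) ⟩
  shift (suc m C 2) (mult 1 (suc d) (suc m) f) n + shift (suc d + m) (shift (m C 2) B) n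
    ≡⟨ cong (shift (suc m C 2) (mult 1 (suc d) (suc m) f) n +_) exponents ⟩
  shift (suc m C 2) (mult 1 (suc d) (suc m) f) n + shift (suc m C 2) (shift (suc d * 1) B) n
    ≡⟨ shift-⊕ (suc m C 2) (mult 1 (suc d) (suc m) f) (shift (suc d * 1) B) n ⟨
  shift (suc m C 2) (mult 1 (suc (suc d)) (suc m) f) n ∎
  where
  open ≡-Reasoning
  B : Series
  B = mult 1 (suc (suc d)) m f
  -- The largest element `suc d + m` gives m to the staircase, raising `m C 2` to `suc m C 2`, and
  -- leaves `suc d` as the largest element of the multiset.
  exponents : shift (suc d + m) (shift (m C 2) B) n ≡ shift (suc m C 2) (shift (suc d * 1) B) n
  exponents = begin
    shift (suc d + m) (shift (m C 2) B) n      ≡⟨ shift-shift (suc d + m) (m C 2) B n ⟩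
    shift (suc d + m + m C 2) B n              ≡⟨ cong (λ e → shift e B n) (+-assoc (suc d) m (m C 2)) ⟩
    shift (suc d + (m + m C 2)) B n            ≡⟨ cong (λ e → shift (suc d + e) B n) ([1+n]C2≡n+nC2 m) ⟨
    shift (suc d + suc m C 2) B n              ≡⟨ cong (λ e → shift e B n) (+-comm (suc d) (suc m C 2)) ⟩
    shift (suc m C 2 + suc d) B n              ≡⟨ cong (λ e → shift (suc m C 2 + e) B n) (*-identityʳ (suc d)) ⟨
    shift (suc m C 2 + suc d * 1) B n          ≡⟨ shift-shift (suc m C 2) (suc d * 1) B n ⟨
    shift (suc m C 2) (shift (suc d * 1) B) n  ∎

-- Weighted sums and the splitting of multisets

-- Σ₂ t k is the sum of t j m over all j and m with m + 2 j = k.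
Σ₂ : (ℕ → ℕ → Series) → ℕ → Series
Σ₂ t zero          = t 0 0
Σ₂ t (suc zero)    = t 0 1
Σ₂ t (suc (suc k)) = t 0 (suc (suc k)) ⊕ Σ₂ (λ j → t (suc j)) k

Σ₂-cong : ∀ {t u} → (∀ j m → t j m ≗ u j m) → ∀ k → Σ₂ t k ≗ Σ₂ u k
Σ₂-cong e zero          = e 0 0
Σ₂-cong e (suc zero)    = e 0 1
Σ₂-cong e (suc (suc k)) = ⊕-cong (e 0 (suc (suc k))) (Σ₂-cong (λ j → e (suc j)) k)

Σ₂-⊕ : ∀ t u k → Σ₂ (λ j m → t j m ⊕ u j m) k ≗ Σ₂ t k ⊕ Σ₂ u k
Σ₂-⊕ t u zero          n = refl
Σ₂-⊕ t u (suc zero)    n = refl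
Σ₂-⊕ t u (suc (suc k)) n = trans
  (cong (t 0 (2 + k) n + u 0 (2 + k) n +_) (Σ₂-⊕ (λ j → t (suc j)) (λ j → u (suc j)) k n))
  (⊕-interchange (t 0 (2 + k)) (u 0 (2 + k)) (Σ₂ (λ j → t (suc j)) k) (Σ₂ (λ j → u (suc j)) k) n)

Σ₂-shift : ∀ d t k → Σ₂ (λ j m → shift d (t j m)) k ≗ shift d (Σ₂ t k)
Σ₂-shift d t zero          n = refl
Σ₂-shift d t (suc zero)    n = refl
Σ₂-shift d t (suc (suc k)) n = trans
  (cong (shift d (t 0 (2 + k)) n +_) (Σ₂-shift d (λ j → t (suc j)) k n))
  (sym (shift-⊕ d (t 0 (2 + k)) (Σ₂ (λ j → t (suc j)) k) n))

-- `t 0 0` stays unconstrained: it does not occur in a positive total.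
Σ₂-𝟘 : ∀ {t} → (∀ j m → t j (suc m) ≗ 𝟘) → (∀ j → t (suc j) 0 ≗ 𝟘) → ∀ k → Σ₂ t (suc k) ≗ 𝟘
Σ₂-𝟘 e e₀ zero          = e 0 0
Σ₂-𝟘 e e₀ (suc zero)    n = cong₂ _+_ (e 0 1 n) (e₀ 0 n)
Σ₂-𝟘 e e₀ (suc (suc k)) n = cong₂ _+_ (e 0 (2 + k) n)
  (Σ₂-𝟘 (λ j → e (suc j)) (λ j → e₀ (suc j)) k n)

-- As generating functions in x with t j m attached to x^(m + 2 j): t = (1 + x qᵈ) u.
Σ₂-peel₁ : ∀ d {t u} → (∀ j → t j 0 ≗ u j 0)
           → (∀ j m → t j (suc m) ≗ u j (suc m) ⊕ shift d (u j m)) →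
           ∀ k → Σ₂ t (suc k) ≗ Σ₂ u (suc k) ⊕ shift d (Σ₂ u k)
Σ₂-peel₁ d e₀ e zero = e 0 0
-- The term `t 1 0` has no subset element to remove, so `e₀` adds no shifted term.
Σ₂-peel₁ d {t} {u} e₀ e (suc zero) n = begin
  t 0 2 n + t 1 0 n                            ≡⟨ cong₂ _+_ (e 0 1 n) (e₀ 1 n) ⟩
  u 0 2 n + shift d (u 0 1) n + u 1 0 n        ≡⟨ xy∙z≈xz∙y (u 0 2 n) (shift d (u 0 1) n) (u 1 0 n) ⟩
  u 0 2 n + u 1 0 n + shift d (u 0 1) n        ∎
  where
  open ≡-Reasoning
Σ₂-peel₁ d {t} {u} e₀ e (suc (suc k)) n = begin
  t 0 (3 + k) n + Σ₂ t′ (suc k) n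
    ≡⟨ cong₂ _+_ (e 0 (2 + k) n) (Σ₂-peel₁ d (λ j → e₀ (suc j)) (λ j → e (suc j)) k n) ⟩
  (u 0 (3 + k) ⊕ shift d (u 0 (2 + k)) ⊕ (Σ₂ u′ (suc k) ⊕ shift d (Σ₂ u′ k))) n
    ≡⟨ ⊕-interchange (u 0 (3 + k)) (shift d (u 0 (2 + k))) (Σ₂ u′ (suc k)) (shift d (Σ₂ u′ k)) n ⟩
  (u 0 (3 + k) ⊕ Σ₂ u′ (suc k) ⊕ (shift d (u 0 (2 + k)) ⊕ shift d (Σ₂ u′ k))) n
    ≡⟨ cong (Σ₂ u (3 + k) n +_) (shift-⊕ d (u 0 (2 + k)) (Σ₂ u′ k) n) ⟨
  (Σ₂ u (3 + k) ⊕ shift d (Σ₂ u (2 + k))) n ∎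
  where
  open ≡-Reasoning
  t′ u′ : ℕ → ℕ → Series
  t′ j = t (suc j)
  u′ j = u (suc j)

-- Likewise (1 − x² qᵈ) t = u.
Σ₂-peel₂ : ∀ d {t u} → (∀ m → t 0 m ≗ u 0 m) → (∀ j m → t (suc j) m ≗ u (suc j) m ⊕ shift d (t j m)) →
           ∀ k → Σ₂ t (2 + k) ≗ Σ₂ u (2 + k) ⊕ shift d (Σ₂ t k)
Σ₂-peel₂ d {t} {u} e₀ e k n = begin
  t 0 (2 + k) n + Σ₂ (λ j → t (suc j)) k n
    ≡⟨ cong₂ _+_ (e₀ (2 + k) n) (Σ₂-cong e k n) ⟩
  u 0 (2 + k) n + Σ₂ (λ j m → u (suc j) m ⊕ shift d (t j m)) k n
    ≡⟨ cong (u 0 (2 + k) n +_) (Σ₂-⊕ (λ j → u (suc j)) (λ j m → shift d (t j m)) k n) ⟩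
  u 0 (2 + k) n + (Σ₂ (λ j → u (suc j)) k n + Σ₂ (λ j m → shift d (t j m)) k n)
    ≡⟨ cong (λ x → u 0 (2 + k) n + (Σ₂ (λ j → u (suc j)) k n + x)) (Σ₂-shift d t k n) ⟩
  u 0 (2 + k) n + (Σ₂ (λ j → u (suc j)) k n + shift d (Σ₂ t k) n)
    ≡⟨ +-assoc (u 0 (2 + k) n) _ _ ⟨
  Σ₂ u (2 + k) n + shift d (Σ₂ t k) n ∎
  where open ≡-Reasoning

-- A doubled j-element multiset from {0, ..., L - 1} with an m-element subset of {0, ..., M - 1}.
-- Separate bounds allow a new value to enter one factor at a time.
split : (L M : ℕ) → Series → ℕ → ℕ → Series
split L M f j m = mult 2 L j (dist M m f)

Σ₂-split-dist : ∀ L M f k →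
  Σ₂ (split L (suc M) f) (suc k) ≗ Σ₂ (split L M f) (suc k) ⊕ shift M (Σ₂ (split L M f) k)
Σ₂-split-dist L M f = Σ₂-peel₁ M (λ j n → refl) λ j m n → trans
  (mult-⊕ 2 L j (dist M (suc m) f) (shift M (dist M m f)) n)
  (cong (mult 2 L j (dist M (suc m) f) n +_) (mult-shift 2 L j M (dist M m f) n))

-- Removing one doubled copy of `L` lowers j by 1, hence the total by 2 and the sum by `L * 2`; this
-- is the defining recursion of `mult`.
Σ₂-split-mult : ∀ L M f k →
  Σ₂ (split (suc L) M f) (2 + k) ≗ Σ₂ (split L M f) (2 + k) ⊕ shift (L * 2) (Σ₂ (split (suc L) M f) k)
Σ₂-split-mult L M f = Σ₂-peel₂ (L * 2) {split (suc L) M f} {split L M f} (λ m n → refl) (λ j m n → refl)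

-- Equivalent to (1 − x² q²ᴸ)⁻¹ (1 + x qᴸ) = (1 − x qᴸ)⁻¹.
Σ₂-split-suc : ∀ L f k → let S = λ L → Σ₂ (split L L f) in
  S (suc L) (suc k) ≗ S L (suc k) ⊕ shift (L * 1) (S (suc L) k)
Σ₂-split-suc L f zero n =
  -- A total of 1 leaves no room for a doubled element, so `split (suc L) L` and `split L L` agree
  -- by computation.
  trans (Σ₂-split-dist (suc L) L f 0 n)
    (cong (λ d → Σ₂ (split (suc L) L f) 1 n + shift d f n) (sym (*-identityʳ L)))
Σ₂-split-suc L f (suc k) n = begin
  Σ₂ (split (suc L) (suc L) f) (2 + k) n
    ≡⟨ Σ₂-split-dist (suc L) L f (suc k) n ⟩
  Σ₂ (split (suc L) L f) (2 + k) n + shift L (U (suc k)) n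
    ≡⟨ cong (_+ shift L (U (suc k)) n) (Σ₂-split-mult L L f k n) ⟩
  S₀ + shift (L * 2) (U k) n + shift L (U (suc k)) n
    ≡⟨ +-assoc S₀ _ _ ⟩
  S₀ + (shift (L * 2) (U k) n + shift L (U (suc k)) n)
    ≡⟨ cong (S₀ +_) (+-comm (shift (L * 2) (U k) n) _) ⟩
  S₀ + (shift L (U (suc k)) n + shift (L * 2) (U k) n)
    ≡⟨ cong (λ d → S₀ + (shift L (U (suc k)) n + shift d (U k) n)) L*2≡L+L ⟩
  S₀ + (shift L (U (suc k)) n + shift (L + L) (U k) n)
    ≡⟨ cong (λ x → S₀ + (shift L (U (suc k)) n + x)) (shift-shift L L (U k) n) ⟨
  S₀ + (shift L (U (suc k)) n + shift L (shift L (U k)) n)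
    -- Both terms share the factor qᴸ; the cofactor is `Σ₂-split-dist` read backwards at total
    -- `suc k`.
    ≡⟨ cong (S₀ +_) (shift-⊕ L (U (suc k)) (shift L (U k)) n) ⟨
  S₀ + shift L (U (suc k) ⊕ shift L (U k)) n
    ≡⟨ cong (S₀ +_) (shift-cong L (Σ₂-split-dist (suc L) L f k) n) ⟨
  S₀ + shift L (Σ₂ (split (suc L) (suc L) f) (suc k)) n
    ≡⟨ cong (λ d → S₀ + shift d (Σ₂ (split (suc L) (suc L) f) (suc k)) n) (*-identityʳ L) ⟨
  S₀ + shift (L * 1) (Σ₂ (split (suc L) (suc L) f) (suc k)) n ∎
  where
  open ≡-Reasoning
  S₀ : ℕ
  S₀ = Σ₂ (split L L f) (2 + k) n
  U : ℕ → Series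
  U = Σ₂ (split (suc L) L f)
  L*2≡L+L : L * 2 ≡ L + L
  L*2≡L+L = trans (*-comm L 2) (cong (L +_) (+-identityʳ L))

-- Both sides satisfy the recursion of `mult 1` in `L` and `k`, with equal boundary values.
mult≗Σ₂-split : ∀ L k f → mult 1 L k f ≗ Σ₂ (split L L f) k
mult≗Σ₂-split L       zero    f n = refl
mult≗Σ₂-split zero    (suc k) f n =
  sym (Σ₂-𝟘 {split 0 0 f} (λ j m → mult-𝟘 2 0 j) (λ j n → refl) k n)
mult≗Σ₂-split (suc L) (suc k) f n = trans
  (cong₂ _+_ (mult≗Σ₂-split L (suc k) f n) (shift-cong (L * 1) (mult≗Σ₂-split (suc L) k f) n))
  (sym (Σ₂-split-suc L f k n))

-- Cardinalities of predicates

private variable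
  A B X : Set

record HasCard {A : Set} (P : A → Set) (c : ℕ) : Set where
  constructor enum
  field
    elements   : List A
    unique     : Unique elements
    membership : ∀ x → x ∈ elements ⇔ P x
    length≡    : length elements ≡ c

-- Duplicate-free lists with the same members are permutations of each other. Thus filtered
-- enumerations can be compared with recursive ones.
HasCard-unique : ∀ {P : A → Set} {a b} → HasCard P a → HasCard P b → a ≡ b
HasCard-unique (enum xs uxs mxs refl) (enum ys uys mys refl) =
  ↭-length (∼bag⇒↭ (unique∧set⇒bag uxs uys λ {x} →
    mk⇔ (from (mys x) ∘ to (mxs x)) (from (mxs x) ∘ to (mys x))))

HasCard-cong : ∀ {P Q : A → Set} {c} → (∀ x → P x ⇔ Q x) → HasCard P c → HasCard Q c
HasCard-cong e (enum xs u m l) =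
  enum xs u (λ x → mk⇔ (to (e x) ∘ to (m x)) (from (m x) ∘ from (e x))) l

HasCard-∅ : ∀ {P : A → Set} → (∀ x → ¬ P x) → HasCard P 0
HasCard-∅ ¬P = enum [] [] (λ x → mk⇔ (λ ()) (⊥-elim ∘ ¬P x)) refl

HasCard-map : ∀ {P : A → Set} {Q : B → Set} {c} (f : A → B) → (∀ {x y} → f x ≡ f y → x ≡ y) →
              (∀ x → P x → Q (f x)) → (∀ y → Q y → ∃ λ x → P x × y ≡ f x) →
              HasCard P c → HasCard Q c
HasCard-map {Q = Q} f inj P⇒Q Q⇒P (enum xs u m l) = enum (map f xs) (Unique.map⁺ inj u)
  (λ y → mk⇔
    (λ y∈ → let x , x∈ , y≡ = ∈-map⁻ f y∈ in subst Q (sym y≡) (P⇒Q x (to (m x) x∈)))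
    (λ q → let x , px , y≡ = Q⇒P y q in subst (_∈ map f xs) (sym y≡) (∈-map⁺ f (from (m x) px))))
  (trans (length-map f xs) l)

HasCard-⊎ : ∀ {P Q : A → Set} {a b} → (∀ x → P x → ¬ Q x) →
            HasCard P a → HasCard Q b → HasCard (λ x → P x ⊎ Q x) (a + b)
HasCard-⊎ disjoint (enum xs uxs mxs lxs) (enum ys uys mys lys) = enum (xs ++ ys)
  (Unique.++⁺ uxs uys λ {x} (x∈xs , x∈ys) → disjoint x (to (mxs x) x∈xs) (to (mys x) x∈ys))
  (λ x → mk⇔
    (Sum.map (to (mxs x)) (to (mys x)) ∘ ∈-++⁻ xs)
    λ { (inj₁ px) → ∈-++⁺ˡ (from (mxs x) px) ; (inj₂ qx) → ∈-++⁺ʳ xs (from (mys x) qx) })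
  (trans (length-++ xs) (cong₂ _+_ lxs lys))

-- The combinatorial counterpart of `shift`: the remainder `r` is a witness, so `n < d` admits no
-- object.
Shifted : ℕ → (ℕ → X → Set) → ℕ → X → Set
Shifted d Q n x = ∃ λ r → d + r ≡ n × Q r x

HasCard-Shifted : ∀ d {Q : ℕ → X → Set} {f : Series} →
  (∀ n → HasCard (Q n) (f n)) →
  ∀ n → HasCard (Shifted d Q n) (shift d f n)
HasCard-Shifted zero    h n    = HasCard-cong (λ x → mk⇔ (λ q → n , refl , q) λ { (_ , refl , q) → q }) (h n)
HasCard-Shifted (suc d) h zero = HasCard-∅ λ { x (_ , () , _) }
HasCard-Shifted (suc d) h (suc n) = HasCard-cong
  (λ x → mk⇔ (λ (r , e , q) → r , cong suc e , q) (λ (r , e , q) → r , suc-injective e , q))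
  (HasCard-Shifted d h n)

-- Box partitions enumerated by largest part

Parts : (c N k : ℕ) → List ℕ → Set
Parts c N k ps = IsPartition ps × length ps ≤ k × All (λ x → c ∣ x × x ≤ N * c) ps

-- One kind of parts placed on top of an arbitrary object of the remaining size; nesting it gives
-- two kinds.
WithParts : (c N k : ℕ) → (ℕ → X → Set) → ℕ → List ℕ × X → Set
WithParts c N k Q n (ps , x) = Parts c N k ps × Shifted (sum ps) Q n x

Parts-[] : ∀ c N k → Parts c N k []
Parts-[] c N k = ([] , []) , z≤n , []

HasCard-trivial : ∀ c N k {Q : ℕ → X → Set} {f : Series} → (∀ ps → Parts c N k ps → ps ≡ []) →
                  (∀ n → HasCard (Q n) (f n)) → ∀ n → HasCard (WithParts c N k Q n) (f n)
HasCard-trivial c N k {Q} only[] h n = HasCard-map ([] ,_) (λ { refl → refl })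
  (λ x q → Parts-[] c N k , n , refl , q) collapse (h n)
  where
  collapse : ∀ y → WithParts c N k Q n y → ∃ λ x → Q n x × y ≡ ([] , x)
  collapse (ps , x) (pps , _ , _ , _) with only[] ps pps
  collapse (.[] , x) (_ , _ , refl , q) | refl = x , q , refl

-- The list descends, so its head decides. A multiple of `c` above `N * c` and at most `suc N * c`
-- equals the latter.
Parts-suc⁻ : ∀ {c} N {k} .{{_ : NonZero c}} ps → Parts c (suc N) (suc k) ps →
             Parts c N (suc k) ps ⊎ (∃ λ qs → ps ≡ suc N * c ∷ qs × Parts c (suc N) k qs)
Parts-suc⁻ {c} N {k} [] _ = inj₁ (Parts-[] c N (suc k))
Parts-suc⁻ {c} N (y ∷ ys) ((0<y ∷ 0<ys , link) , s≤s len , (c∣y@(divides i refl) , y≤) ∷ ys≤)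
  with i * c ≤? N * c
... | yes y≤N = inj₁ ((0<y ∷ 0<ys , link) , s≤s len ,
  (c∣y , y≤N) ∷ All.zipWith (λ ((c∣z , _) , z≤y) → c∣z , ≤-trans z≤y y≤N)
    (ys≤ , All.tail (Linked⇒All (λ p q → ≤-trans q p) ≤-refl link)))
... | no y≰N = inj₂ (ys ,
  cong (λ i → i * c ∷ ys) (≤-antisym (*-cancelʳ-≤ i (suc N) c y≤)
    (*-cancelʳ-< c N i (≰⇒> y≰N))) ,
  ((0<ys , Linked.tail link) , len , ys≤))

Parts-weaken : ∀ {c} N {k ps} → Parts c N k ps → Parts c (suc N) k ps
Parts-weaken {c} N (isP , len , ps≤) =
  isP , len , All.map (λ (c∣x , x≤) → c∣x , ≤-trans x≤ (m≤n+m (N * c) c)) ps≤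

Parts-∷ : ∀ {c} N {k ps} .{{_ : NonZero c}} →
          Parts c (suc N) k ps → Parts c (suc N) (suc k) (suc N * c ∷ ps)
Parts-∷ {c} N ((pos , link) , len , ps≤) =
  (>-nonZero⁻¹ (suc N * c) {{m*n≢0 (suc N) c}} ∷ pos , linked ps≤ link) , s≤s len ,
  (divides-refl (suc N) , ≤-refl) ∷ ps≤
  where
  linked : ∀ {m ps} → All (λ x → c ∣ x × x ≤ m) ps → Linked _≥_ ps → Linked _≥_ (m ∷ ps)
  linked []              _    = [-]
  linked ((_ , x≤m) ∷ _) link = x≤m ∷ link

-- Either all parts are at most N c, or the largest part is (N + 1) c.
HasCard-WithParts : ∀ c N k .{{_ : NonZero c}} {Q : ℕ → X → Set} {f : Series} →
  (∀ n → HasCard (Q n) (f n)) →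
  ∀ n → HasCard (WithParts c N k Q n) (mult c (suc N) k f n)
HasCard-WithParts c N zero h = HasCard-trivial c N 0 (λ { [] _ → refl ; (_ ∷ _) (_ , () , _) }) h
-- No positive part is at most 0; likewise {0} carries a single multiset of each size.
HasCard-WithParts c zero (suc k) {f = f} h n = subst (HasCard _) (sym (mult-one c (suc k) f n))
  (HasCard-trivial c 0 (suc k)
    (λ { [] _ → refl
       ; (_ ∷ _) ((0<x ∷ _ , _) , _ , (_ , x≤0) ∷ _) → contradiction 0<x (≤⇒≯ x≤0) }) h n)
HasCard-WithParts {X = X} c (suc N) (suc k) {Q} h n =
  HasCard-cong recombine
    (HasCard-⊎ disjoint (HasCard-WithParts c N (suc k) h n)
      (HasCard-map (map₁ (M ∷_)) (λ { refl → refl }) (λ _ w → _ , refl , w)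
        (λ { _ (x , refl , w) → x , w , refl })
        (HasCard-Shifted M (HasCard-WithParts c (suc N) k h) n)))
  where
  M : ℕ
  M = suc N * c
  Small Large : List ℕ × X → Set
  Small = WithParts c N (suc k) Q n
  Large y = ∃ λ x → y ≡ map₁ (M ∷_) x × Shifted M (WithParts c (suc N) k Q) n x
  disjoint : ∀ x → Small x → ¬ Large x
  disjoint _ ((_ , _ , (_ , M≤) ∷ _) , _) (_ , refl , _) = <⇒≱ (m<n+m (N * c) (>-nonZero⁻¹ c)) M≤
  recombine : ∀ x → (Small x ⊎ Large x) ⇔ WithParts c (suc N) (suc k) Q n x
  recombine (ps , x) = mk⇔ forth back
    where
    forth : Small (ps , x) ⊎ Large (ps , x) → WithParts c (suc N) (suc k) Q n (ps , x)
    forth (inj₁ (pps , w)) = Parts-weaken N pps , w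
    forth (inj₂ ((qs , _) , refl , _ , e , pqs , r , refl , q)) =
      Parts-∷ N pqs , r , trans (+-assoc M (sum qs) r) e , q
    back : WithParts c (suc N) (suc k) Q n (ps , x) → Small (ps , x) ⊎ Large (ps , x)
    back (pps , r , e , q) with Parts-suc⁻ N ps pps
    ... | inj₁ small = inj₁ (small , r , e , q)
    ... | inj₂ (qs , refl , pqs) =
      inj₂ ((qs , x) , refl , sum qs + r , trans (sym (+-assoc M (sum qs) r)) e , pqs , r , refl , q)

-- Both sides of the identity as coefficients

Zero : ℕ → ⊤ → Set
Zero n _ = n ≡ 0

HasCard-Zero : ∀ n → HasCard (Zero n) (𝟙 n)
HasCard-Zero zero    = enum (tt ∷ []) ([] ∷ []) (λ _ → mk⇔ (λ _ → refl) (λ _ → here refl)) refl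
HasCard-Zero (suc n) = HasCard-∅ λ _ ()

unit-parts⁺ : ∀ {N ps} → All (_≤ N) ps → All (λ x → 1 ∣ x × x ≤ N * 1) ps
unit-parts⁺ {N} = All.map λ {x} x≤N → 1∣ x , ≤-trans x≤N (≤-reflexive (sym (*-identityʳ N)))

unit-parts⁻ : ∀ {N ps} → All (λ x → 1 ∣ x × x ≤ N * 1) ps → All (_≤ N) ps
unit-parts⁻ {N} = All.map λ (_ , x≤) → ≤-trans x≤ (≤-reflexive (*-identityʳ N))

-- Padding with zeros turns at most k parts into exactly k elements of {0, ..., N}, hence `suc N`.
p≡mult : ∀ N k n → p N k n ≡ mult 1 (suc N) k 𝟙 n
p≡mult N k n = HasCard-unique
  (enum (boxed N k n) (boxed-unique N k n) (∈-boxed N k n) refl)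
  (HasCard-map proj₁ (λ { refl → refl })
    (λ { (ps , _) ((isP , len , ps≤) , .0 , e , refl) →
           isP , trans (sym (+-identityʳ (sum ps))) e , len , unit-parts⁻ ps≤ })
    (λ ps (isP , e , len , ps≤) →
      (ps , tt) , ((isP , len , unit-parts⁺ ps≤) , 0 , trans (+-identityʳ (sum ps)) e , refl) , refl)
    (HasCard-WithParts 1 N k HasCard-Zero n))

twoKind≡mult : ∀ r .{{_ : NonZero r}} N₁ N₂ k₁ k₂ n →
  length (twoKind r N₁ N₂ k₁ k₂ n) ≡ mult r (suc N₁) k₁ (mult 1 (suc N₂) k₂ 𝟙) n
twoKind≡mult r N₁ N₂ k₁ k₂ n = HasCard-unique
  (enum (twoKind r N₁ N₂ k₁ k₂ n) (twoKind-unique r N₁ N₂ k₁ k₂ n) (∈-twoKind r N₁ N₂ k₁ k₂ n) refl)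
  (HasCard-map (λ (ps , qs , _) → ps , qs) (λ { refl → refl })
    (λ { (ps , qs , _) ((isP , lenP , ps≤) , _ , e , (isQ , lenQ , qs≤) , .0 , refl , refl) →
           isP , isQ , trans (cong (sum ps +_) (sym (+-identityʳ (sum qs)))) e ,
           lenP , ps≤ , lenQ , unit-parts⁻ qs≤ })
    (λ (ps , qs) (isP , isQ , e , lenP , ps≤ , lenQ , qs≤) →
      (ps , qs , tt) ,
      ((isP , lenP , ps≤) , sum qs , e , (isQ , lenQ , unit-parts⁺ qs≤) , 0 , +-identityʳ (sum qs) , refl) ,
      refl)
    (HasCard-WithParts r N₁ k₁ (HasCard-WithParts 1 N₂ k₂ HasCard-Zero) n))

-- Writing k as m + 2 j in the hypothesis spares the summands any subtraction.
∑≡Σ₂ : ∀ (t : ℕ → ℕ → Series) n k (g : ℕ → ℕ) → (∀ j m → k ≡ m + 2 * j → g j ≡ t j m n) →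
       ∑[0⋯ ⌊ k /2⌋ ] g ≡ Σ₂ t k n
∑≡Σ₂ t n k g e = trans (cong sum (map-upTo g (suc ⌊ k /2⌋))) (go t k g e)
  where
  go : ∀ (t : ℕ → ℕ → Series) k (g : ℕ → ℕ) → (∀ j m → k ≡ m + 2 * j → g j ≡ t j m n) →
       sum (applyUpTo g (suc ⌊ k /2⌋)) ≡ Σ₂ t k n
  go t zero          g e = trans (+-identityʳ (g 0)) (e 0 0 refl)
  go t (suc zero)    g e = trans (+-identityʳ (g 0)) (e 0 1 refl)
  go t (suc (suc k)) g e = cong₂ _+_ (e 0 (2 + k) (sym (+-identityʳ (2 + k))))
    (go (λ j → t (suc j)) k (λ j → g (suc j)) λ j m eq → e (suc j) m (begin
      2 + k             ≡⟨ cong (2 +_) eq ⟩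
      2 + (m + 2 * j)   ≡⟨ x∙yz≈y∙xz 2 m (2 * j) ⟩
      m + (2 + 2 * j)   ≡⟨ cong (m +_) (*-suc 2 j) ⟨
      m + 2 * suc j     ∎))
    where
    open ≡-Reasoning

-- Truncation of the box parameters

open import Data.Integer.Base as ℤ using (+_)
import Data.Integer.Properties as ℤ

-- Exposes the negative constructor, on which `pbar` computes to 0.
m<n⇒m⊖n≡-[1+] : ∀ {m n} → m < n → ∃ λ e → m ℤ.⊖ n ≡ ℤ.-[1+ e ]
m<n⇒m⊖n≡-[1+] {m} {n} m<n with n ∸ m in eq | ℤ.⊖-< m<n
... | zero  | _ = contradiction (m∸n≡0⇒m≤n eq) (<⇒≱ m<n)
... | suc e | ⊖≡ = e , ⊖≡

-- The zero convention fits: if `suc N < m`, then {0, ..., N} has no m-element subset; if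
-- `n < m C 2`, the staircase alone exceeds n. Otherwise `dist-staircase` applies.
pbar≡split : ∀ N j m n →
  pbar 2 (+ N) (suc N ℤ.⊖ m) (+ j) (+ m) (n ℤ.⊖ (m C 2)) ≡ split (suc N) (suc N) 𝟙 j m n
pbar≡split N j m n with m ≤? suc N | m C 2 ≤? n
... | no m≰N | _ with e , eq ← m<n⇒m⊖n≡-[1+] (≰⇒> m≰N) rewrite eq =
  sym (trans (mult-cong 2 (suc N) j (dist-< 𝟙 (≰⇒> m≰N)) n) (mult-𝟘 2 (suc N) j n))
... | yes m≤N | C≤? = trans (cong (λ i → pbar 2 (+ N) i (+ j) (+ m) (n ℤ.⊖ (m C 2))) (ℤ.⊖-≥ m≤N))
  (trans (pbar-⊖ C≤?) (sym split≡))
  where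
  open ≡-Reasoning
  d : ℕ
  d = suc N ∸ m
  T : Series
  T = mult 2 (suc N) j (mult 1 (suc d) m 𝟙)
  split≡ : split (suc N) (suc N) 𝟙 j m n ≡ shift (m C 2) T n
  split≡ = begin
    mult 2 (suc N) j (dist (suc N) m 𝟙) n
      ≡⟨ cong (λ L → mult 2 (suc N) j (dist L m 𝟙) n) (m∸n+n≡m m≤N) ⟨
    mult 2 (suc N) j (dist (d + m) m 𝟙) n
      ≡⟨ mult-cong 2 (suc N) j (dist-staircase d m 𝟙) n ⟩
    mult 2 (suc N) j (shift (m C 2) (mult 1 (suc d) m 𝟙)) n
      ≡⟨ mult-shift 2 (suc N) j (m C 2) (mult 1 (suc d) m 𝟙) n ⟩
    shift (m C 2) T n ∎
  pbar-⊖ : Dec (m C 2 ≤ n) → pbar 2 (+ N) (+ d) (+ j) (+ m) (n ℤ.⊖ (m C 2)) ≡ shift (m C 2) T n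
  pbar-⊖ (yes C≤n) rewrite ℤ.⊖-≥ C≤n = trans (twoKind≡mult 2 N d j m (n ∸ m C 2)) (sym (shift-≤ T C≤n))
  pbar-⊖ (no C≰n) with e , eq ← m<n⇒m⊖n≡-[1+] (≰⇒> C≰n) rewrite eq = sym (shift-> T (≰⇒> C≰n))

-- Evaluation of the summands and conclusion

m+n-n≡m : ∀ m n → + (m + n) ℤ.- + n ≡ + m
m+n-n≡m m n = trans (ℤ.m-n≡m⊖n (m + n) n) (trans (ℤ.⊖-≥ (m≤n+m n m)) (cong +_ (m+n∸n≡m m n)))

N+1-[m+n]+n≡[1+N]⊖m : ∀ N m n → + N ℤ.+ + 1 ℤ.- + (m + n) ℤ.+ + n ≡ suc N ℤ.⊖ m
N+1-[m+n]+n≡[1+N]⊖m N m n = begin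
  + N ℤ.+ + 1 ℤ.- + (m + n) ℤ.+ + n        ≡⟨ cong (ℤ._+ + n) (ℤ.m-n≡m⊖n (N + 1) (m + n)) ⟩
  (N + 1) ℤ.⊖ (m + n) ℤ.+ + n              ≡⟨ ℤ.distribˡ-⊖-+-pos n (N + 1) (m + n) ⟩
  (N + 1 + n) ℤ.⊖ (m + n)                  ≡⟨ cong₂ ℤ._⊖_ N+1+n≡n+[1+N] (+-comm m n) ⟩
  (n + suc N) ℤ.⊖ (n + m)                  ≡⟨ ℤ.+-cancelˡ-⊖ n (suc N) m ⟩
  suc N ℤ.⊖ m                              ∎
  where
  open ≡-Reasoning
  N+1+n≡n+[1+N] : N + 1 + n ≡ n + suc N
  N+1+n≡n+[1+N] = trans (cong (_+ n) (+-comm N 1)) (+-comm (suc N) n)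

-- With k = m + 2 j, the integer difference and the truncated `k ∸ 2 * j` both reduce to m.
summand≡split : ∀ N n j m → let k = m + 2 * j in
  pbar 2 (+ N) (+ N ℤ.+ + 1 ℤ.- + k ℤ.+ + (2 * j)) (+ j) (+ k ℤ.- + (2 * j)) (+ n ℤ.- + ((k ∸ 2 * j) C 2))
    ≡ split (suc N) (suc N) 𝟙 j m n
summand≡split N n j m
  rewrite N+1-[m+n]+n≡[1+N]⊖m N m (2 * j) | m+n-n≡m m (2 * j) | m+n∸n≡m m (2 * j)
        | ℤ.m-n≡m⊖n n (m C 2) = pbar≡split N j m n

theorem3p1 : ∀ (N k n : ℕ) →
    p N k n ≡
    ∑[0⋯ ⌊ k /2⌋ ] (λ j →
    pbar 2
    (+ N)
    (+ N ℤ.+ + 1 ℤ.- + k ℤ.+ + (2 * j))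
    (+ j)
    (+ k ℤ.- + (2 * j))
    (+ n ℤ.- + ((k ∸ 2 * j) C 2)))
theorem3p1 N k n = begin
  p N k n                           ≡⟨ p≡mult N k n ⟩
  mult 1 (suc N) k 𝟙 n              ≡⟨ mult≗Σ₂-split (suc N) k 𝟙 n ⟩
  Σ₂ (split (suc N) (suc N) 𝟙) k n  ≡⟨ ∑≡Σ₂ (split (suc N) (suc N) 𝟙) n k _ (λ { j m refl → summand≡split N n j m }) ⟨
  ∑[0⋯ ⌊ k /2⌋ ] _                  ∎
  where open ≡-Reasoning
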